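{- For $n\ge 2$ let $G_n$ be the intersection graph of the $\binom{n}{2}$ closed intervals $[i,j]$, $1\le i<j\le n$ (two intervals adjacent iff they intersect). If $G_n$ is the union of $t$ comparability subgraphs $H_1,\dots,H_t$ (i.e. $E(G_n)=\bigcup_{i=1}^t E(H_i)$), then $t\ge \frac12\log\log n$, where logarithms are base $2$.
   Context: A comparability graph is a graph admitting a transitive orientation (equivalently, the comparability graph of a partial order). -}

module Defs where

open import Data.Integer.Base using (+_)
open import Data.Nat.Base as ℕ using (ℕ)
open import Data.Product.Base using (_×_; _,_)
open import Data.Rational.Base as ℚ using (ℚ)
open import Data.Rational.Literals using (fromℤ)
open import Data.Refinement using (Refinement; value)
open import Data.Sum.Base using (_⊎_)
open import Level using (0ℓ)
open import Relation.Binary.Core using (Rel)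
open import Relation.Binary.Definitions using (Asymmetric; Symmetric; Transitive)
open import Relation.Binary.PropositionalEquality using (_≢_; refl; ≢-sym)
open import Relation.Nullary.Negation using (¬_)
open import Relation.Unary using (Pred; _∈_; _≬_)

record Graph : Set₁ where
  field
    Vertex   : Set
    Adj      : Rel Vertex 0ℓ
    symm     : Symmetric Adj
    loopless : ∀ v → ¬ Adj v v

open Graph public

-- A subgraph need not be spanning or induced.
record Subgraph (G : Graph) : Set₁ where
  field
    verts    : Pred (Vertex G) 0ℓ
    adj      : Rel (Vertex G) 0ℓ
    adj-symm : Symmetric adj
    adj⇒Adj  : ∀ {u v} → adj u v → Adj G u v
    adj⇒∈    : ∀ {u v} → adj u v → u ∈ verts

open Subgraph public

-- Membership proofs in `Refinement` are irrelevant, so a vertex of G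
-- contributes at most one vertex here.
toGraph : {G : Graph} → Subgraph G → Graph
toGraph {G} H = record
  { Vertex   = Refinement (Vertex G) (verts H)
  ; Adj      = λ u v → adj H (value u) (value v)
  ; symm     = adj-symm H
  ; loopless = λ v e → loopless G (value v) (adj⇒Adj H e)
  }

record TransitiveOrientation (G : Graph) : Set₁ where
  field
    Arc     : Rel (Vertex G) 0ℓ
    arc⇒Adj : ∀ {u v} → Arc u v → Adj G u v
    Adj⇒arc : ∀ {u v} → Adj G u v → Arc u v ⊎ Arc v u
    asym    : Asymmetric Arc
    trans   : Transitive Arc

ComparabilityGraph : Graph → Set₁
ComparabilityGraph = TransitiveOrientation

intersectionGraph : {I X : Set} → (I → Pred X 0ℓ) → Graph
intersectionGraph {I} F = record
  { Vertex   = I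
  ; Adj      = λ a b → a ≢ b × F a ≬ F b
  ; symm     = λ { (a≢b , x , x∈a , x∈b) → ≢-sym a≢b , x , x∈b , x∈a }
  ; loopless = λ _ (a≢a , _) → a≢a refl
  }

record Interval (n : ℕ) : Set where
  field
    lower        : ℕ
    upper        : ℕ
    .1≤lower     : 1 ℕ.≤ lower
    .lower<upper : lower ℕ.< upper
    .upper≤n     : upper ℕ.≤ n

open Interval public

-- Points are rational rather than real. Intersection is unaffected: if
-- [i , j] and [k , l] meet at all, they meet at the integer max i k.
points : ∀ {n} → Interval n → Pred ℚ 0ℓ
points I x = fromℤ (+ lower I) ℚ.≤ x × x ℚ.≤ fromℤ (+ upper I)

intervalGraph : ℕ → Graph
intervalGraph n = intersectionGraph (points {n})

{-# OPTIONS --safe #-}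
-- For i < j < k < l the intervals [i,j] and [j,k] meet, while [i,j] and [k,l]
-- do not. Label the edge [i,j] — [j,k] by some Hₛ containing it together with the
-- direction of its arc there. If two consecutive edges [i,j] — [j,k] — [k,l] had
-- the same label, transitivity would make [i,j] and [k,l] adjacent. Hence the
-- labels properly colour the shift graph of triples with 2 * t colours. Passing
-- from arcs to vertices (the vertex colour being the set of colours of incoming
-- arcs) exponentiates the number of colours; doing so twice, from triples to
-- pairs to points, gives an injection of n points into 2 ^ (2 ^ (2 * t)) colours.
module Submission where

open import Data.Fin.Base as Fin using (Fin; zero; suc; toℕ; combine; funToFin; finToFun)
open import Data.Fin.Properties as Fin using (toℕ<n; any?; combine-injective; finToFun-funToFin; injective⇒≤)
open import Data.Integer.Base as ℤ using (+_)
import Data.Integer.Properties as ℤ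
open import Data.Irrelevant using ([_])
open import Data.Nat.Base as ℕ using (ℕ; suc; _≤_; _*_; _^_; s≤s; z≤n)
import Data.Nat.Properties as ℕ
open import Data.Product.Base using (∃; ∃₂; _,_; proj₁)
open import Data.Rational.Base as ℚ using (*≤*)
import Data.Rational.Properties as ℚ
open import Data.Rational.Literals using (fromℤ)
open import Data.Refinement using (_,_)
open import Data.Sum.Base using (inj₁; inj₂)
open import Function.Base using (_∘_)
open import Function.Bundles using (_⇔_; Equivalence)
open import Level using (0ℓ)
open import Relation.Binary.Core using (Rel)
open import Relation.Binary.Definitions using (tri<; tri≈; tri>)
open import Relation.Binary.PropositionalEquality using (_≡_; _≢_; refl; sym; trans; cong; subst; subst₂)
open import Relation.Nullary.Decidable using (Dec; yes; no; map′)
open import Relation.Nullary.Negation using (¬_; contradiction)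
open import Relation.Unary using (_∈_)
open import Defs

module _ {A : Set} {E : Rel A 0ℓ} {m : ℕ}
         (φ : ∀ {x y} → E x y → Fin m)
         (proper : ∀ {x y z} (e : E x y) (f : E y z) → φ e ≢ φ f)
         (enters? : ∀ y c → Dec (∃₂ λ x (e : E x y) → φ e ≡ c))
         where

  private
    indicator : {P : Set} → Dec P → Fin 2
    indicator (yes _) = suc zero
    indicator (no _)  = zero

    indicator-≢ : {P Q : Set} (P? : Dec P) (Q? : Dec Q) → ¬ P → Q → indicator P? ≢ indicator Q?
    indicator-≢ (yes p) _       ¬p q _  = ¬p p
    indicator-≢ (no _)  (no ¬q) ¬p q _  = ¬q q
    indicator-≢ (no _)  (yes _) ¬p q ()

    incoming : A → Fin m → Fin 2
    incoming y c = indicator (enters? y c)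

  -- A set of colours, coded as a number through its indicator function; `enters?` makes the
  -- indicator computable.
  vertexColour : A → Fin (2 ^ m)
  vertexColour y = funToFin (incoming y)

  -- The colour `φ e` tells the two ends apart: it enters `y` along `e`, whereas an arc of that
  -- colour entering `x` would be followed by `e`, contradicting `proper`.
  vertexColour-proper : ∀ {x y} → E x y → vertexColour x ≢ vertexColour y
  vertexColour-proper {x} {y} e eq =
    indicator-≢ (enters? x (φ e)) (enters? y (φ e))
      (λ (_ , d , φd≡φe) → proper d e φd≡φe) (x , e , refl)
      (trans (sym (finToFun-funToFin (incoming x) (φ e)))
        (trans (cong (λ c → finToFun c (φ e)) eq)
          (finToFun-funToFin (incoming y) (φ e))))

-- Proofs of `i Fin.< j` are unique, so deciding `P` at one of them settles it for all; what remains
-- is a finite search over `i`.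
anyBelow? : ∀ {n} {j : Fin n} (P : {i : Fin n} → i Fin.< j → Set) →
  ({i : Fin n} (p : i Fin.< j) → Dec (P p)) → Dec (∃₂ λ (i : Fin n) (p : i Fin.< j) → P p)
anyBelow? {j = j} P P? = any? λ i → below i (i Fin.<? j)
  where
  below : ∀ i → Dec (i Fin.< j) → Dec (∃ λ (p : i Fin.< j) → P p)
  below i (no i≮j) = no (i≮j ∘ proj₁)
  below i (yes p)  = map′ (p ,_) (λ (q , Pq) → subst P (Fin.<-irrelevant q p) Pq) (P? p)

-- Any two distinct points are joined by an arc, so a proper vertex colouring is injective.
shiftColouring₂⇒≤ : ∀ {n m} (φ : {i j : Fin n} → i Fin.< j → Fin m) →
  (∀ {i j k} (p : i Fin.< j) (q : j Fin.< k) → φ p ≢ φ q) →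
  n ≤ 2 ^ m
shiftColouring₂⇒≤ {n} {m} φ proper = injective⇒≤ injective
  where
  enters? : ∀ j c → Dec (∃₂ λ (i : Fin n) (p : i Fin.< j) → φ p ≡ c)
  enters? j c = anyBelow? (λ p → φ p ≡ c) (λ p → φ p Fin.≟ c)

  ψ : Fin n → Fin (2 ^ m)
  ψ = vertexColour φ proper enters?

  ψ-proper : ∀ {i j} → i Fin.< j → ψ i ≢ ψ j
  ψ-proper = vertexColour-proper φ proper enters?

  injective : ∀ {i j} → ψ i ≡ ψ j → i ≡ j
  injective {i} {j} eq with Fin.<-cmp i j
  ... | tri< i<j _ _ = contradiction eq (ψ-proper i<j)
  ... | tri≈ _ i≡j _ = i≡j
  ... | tri> _ _ j<i = contradiction (sym eq) (ψ-proper j<i)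

shiftColouring₃⇒≤ : ∀ {n m} (φ : {i j k : Fin n} → i Fin.< j → j Fin.< k → Fin m) →
  (∀ {i j k l} (p : i Fin.< j) (q : j Fin.< k) (r : k Fin.< l) → φ p q ≢ φ q r) →
  n ≤ 2 ^ (2 ^ m)
shiftColouring₃⇒≤ {n} {m} φ proper =
  shiftColouring₂⇒≤ (λ p → vertexColour χ χ-proper enters? (_ , _ , p))
    (λ p q → vertexColour-proper χ χ-proper enters? {_ , _ , p} {_ , _ , q} refl)
  where
  Pair : Set
  Pair = ∃₂ λ (i j : Fin n) → i Fin.< j

  -- A triple i < j < k is an arc from the pair (i, j) to the pair (j, k).
  Consecutive : Rel Pair 0ℓ
  Consecutive (_ , j , _) (j′ , _ , _) = j ≡ j′

  χ : ∀ {x y} → Consecutive x y → Fin m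
  χ {_ , _ , p} {_ , _ , q} refl = φ p q

  χ-proper : ∀ {x y z} (e : Consecutive x y) (f : Consecutive y z) → χ {x} {y} e ≢ χ {y} {z} f
  χ-proper {_ , _ , p} {_ , _ , q} {_ , _ , r} refl refl = proper p q r

  enters? : ∀ y c → Dec (∃₂ λ x (e : Consecutive x y) → χ {x} {y} e ≡ c)
  enters? (j , _ , q) c = map′
    (λ (i , p , eq) → (i , j , p) , refl , eq)
    (λ { ((i , _ , p) , refl , eq) → i , p , eq })
    (anyBelow? (λ {i} p → φ {i} p q ≡ c) (λ p → φ p q Fin.≟ c))

fromℤ-mono-≤ : ∀ {i j} → i ℤ.≤ j → fromℤ i ℚ.≤ fromℤ j
fromℤ-mono-≤ {i} {j} i≤j =
  *≤* (subst₂ ℤ._≤_ (sym (ℤ.*-identityʳ i)) (sym (ℤ.*-identityʳ j)) i≤j)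

fromℤ-cancel-≤ : ∀ {i j} → fromℤ i ℚ.≤ fromℤ j → i ℤ.≤ j
fromℤ-cancel-≤ {i} {j} (*≤* i≤j) =
  subst₂ ℤ._≤_ (ℤ.*-identityʳ i) (ℤ.*-identityʳ j) i≤j

interval : ∀ {n} {i j : Fin n} → i Fin.< j → Interval n
interval {i = i} {j} i<j = record
  -- Elements of `Fin n` count from 0, endpoints from 1.
  { lower       = suc (toℕ i)
  ; upper       = suc (toℕ j)
  ; 1≤lower     = s≤s z≤n
  ; lower<upper = s≤s i<j
  ; upper≤n     = toℕ<n j
  }

touching⇒Adj : ∀ {n} {i j k : Fin n} (p : i Fin.< j) (q : j Fin.< k) →
  Adj (intervalGraph n) (interval p) (interval q)
touching⇒Adj {j = j} p q =
  (λ eq → ℕ.<⇒≢ (s≤s p) (cong lower eq)) ,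
  fromℤ (+ suc (toℕ j)) ,
  (fromℤ-mono-≤ (ℤ.+≤+ (ℕ.<⇒≤ (s≤s p))) , ℚ.≤-refl) ,
  (ℚ.≤-refl , fromℤ-mono-≤ (ℤ.+≤+ (ℕ.<⇒≤ (s≤s q))))

Adj⇒lower≤upper : ∀ {n} (u v : Interval n) → Adj (intervalGraph n) u v → lower v ≤ upper u
Adj⇒lower≤upper _ _ (_ , _ , (_ , x≤u) , (v≤x , _)) =
  ℤ.drop‿+≤+ (fromℤ-cancel-≤ (ℚ.≤-trans v≤x x≤u))

module _ {G : Graph} (H : Subgraph G) (O : TransitiveOrientation (toGraph H)) where

  open TransitiveOrientation O using (Arc; arc⇒Adj; Adj⇒arc) renaming (trans to Arc-trans)

  -- The direction is a `Fin 2` so that `combine` can merge it with the index of a subgraph.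
  Directed : Fin 2 → Rel (Vertex G) 0ℓ
  Directed zero    u v = ∃₂ λ (p : u ∈ verts H) (q : v ∈ verts H) → Arc (u , [ p ]) (v , [ q ])
  Directed (suc _) u v = Directed zero v u

  adj⇒Directed : ∀ {u v} → adj H u v → ∃ λ d → Directed d u v
  adj⇒Directed e with adj⇒∈ H e | adj⇒∈ H (adj-symm H e)
  ... | p | q with Adj⇒arc {_ , [ p ]} {_ , [ q ]} e
  ... | inj₁ a = zero , p , q , a
  ... | inj₂ a = suc zero , q , p , a

  Directed-trans⇒Adj : ∀ d {u v w} → Directed d u v → Directed d v w → Adj G u w
  -- The two membership proofs for `v` agree by irrelevance, so the arcs compose.
  Directed-trans⇒Adj zero (_ , _ , a) (_ , _ , b) = adj⇒Adj H (arc⇒Adj (Arc-trans a b))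
  Directed-trans⇒Adj (suc _) a b = symm G (Directed-trans⇒Adj zero b a)

-- Taking base-2 logarithms twice turns the bound into log log n ≤ 2t.
theorem7 : ∀ (n t : ℕ) → 2 ≤ n →
    (H : Fin t → Subgraph (intervalGraph n)) →
    (∀ i → ComparabilityGraph (toGraph (H i))) →
    (∀ u v → Adj (intervalGraph n) u v ⇔ ∃ λ i → adj (H i) u v) →
    n ≤ 2 ^ (2 ^ (2 * t))
theorem7 n t _ H O cover =
  shiftColouring₃⇒≤ (λ p q → code p q (label p q))
    (λ p q r → code-proper p q r (label p q) (label q r))
  where
  Label : ∀ {i j k : Fin n} → i Fin.< j → j Fin.< k → Set
  Label p q = ∃₂ λ d s → Directed (H s) (O s) d (interval p) (interval q)

  label : ∀ {i j k} (p : i Fin.< j) (q : j Fin.< k) → Label p q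
  label p q =
    let s , e = Equivalence.to (cover (interval p) (interval q)) (touching⇒Adj p q)
        d , a = adj⇒Directed (H s) (O s) e
    in d , s , a

  -- With the label as an argument its components are variables, so equal codes can be matched with
  -- `refl`.
  code : ∀ {i j k} (p : i Fin.< j) (q : j Fin.< k) → Label p q → Fin (2 * t)
  code p q (d , s , _) = combine d s

  code-proper : ∀ {i j k l} (p : i Fin.< j) (q : j Fin.< k) (r : k Fin.< l)
    (a : Label p q) (b : Label q r) → code p q a ≢ code q r b
  code-proper p q r (d , s , a) (d′ , s′ , b) eq with combine-injective d s d′ s′ eq
  ... | refl , refl =
    -- The two arcs chain in one orientation, so `interval r` would start no later than `interval p`
    -- ends, against j < k.
    ℕ.<⇒≱ (s≤s q) (Adj⇒lower≤upper (interval p) (interval r)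
      (Directed-trans⇒Adj (H s) (O s) d a b))
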